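{- Let $G = (V, E)$ be a graph and $\rho \in \mathbb{Z}_+$ be a positive integer. Let $\mathcal{M} := (E, \mathcal{I})$ denote the pseudoforest matroid on the graph $G = (V, E)$, where a set of edges $E'\subseteq E$ is independent if every connected component of the subgraph $G' = (V, E')$ has at most one cycle. Let $\mathcal{M}_{\rho} := (E, \mathcal{I}_\rho)$ be the $\rho$-fold union of the pseudoforest matroid. Then, for every subset $F \subseteq V$, we have $E[V - F] \in \mathcal{I}_\rho$ if and only if $\lambda^*_{G - F} \leq \rho$.
   Context: For a graph $G=(V,E)$, $E[S]$ is the set of edges with both end vertices in $S$, and $\lambda^*_G:=\max\{|E[S]|/|S|:\emptyset\ne S\subseteq V\}$ (for a graph with no vertices the condition $\lambda^*_G\le\rho$ is considered to hold). For a positive integer $\rho$, the $\rho$-fold union of a matroid $\mathcal{M}=(E,\mathcal{I})$ is the matroid $\mathcal{M}_\rho=(E,\mathcal{I}_\rho)$ in which a set $A\subseteq E$ belongs to $\mathcal{I}_\rho$ if and only if $A$ can be partitioned into $\rho$ (possibly empty) parts, each of which belongs to $\mathcal{I}$. -}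

module Defs where

open import Data.Bool.Base using (true)
open import Data.Fin.Base using (Fin)
open import Data.Fin.Subset using (Subset; inside; outside; _∈_; _⊆_; _─_; ∣_∣)
open import Data.Fin.Subset.Properties using (_∈?_; _⊆?_; nonempty?)
open import Data.Integer.Base using (+_)
open import Data.List.Base using (List; []; _∷_; _++_; map; filter; foldr)
open import Data.List.Relation.Binary.BagAndSetEquality using (_∼[_]_; set)
open import Data.List.Relation.Unary.All using (All)
open import Data.List.Relation.Unary.Unique.Propositional using (Unique)
open import Data.Nat.Base using (ℕ; zero; suc)
open import Data.Product.Base using (Σ; ∃; _×_; _,_; proj₁; proj₂)
open import Data.Rational.Base using (ℚ; 0ℚ; _/_; _⊔_)
open import Data.Sum.Base using (_⊎_)
open import Data.Vec.Base using ([]; _∷_; tabulate)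
open import Data.Vec.Properties using (lookup∘tabulate; []=⇒lookup)
open import Level using (0ℓ)
open import Relation.Binary.PropositionalEquality using (_≡_; _≢_; sym; trans)
open import Relation.Nullary using (Dec; does; yes)
open import Relation.Nullary.Decidable using (_×-dec_)
open import Relation.Unary using (Pred)

private
  variable
    n m : ℕ

  holds : {P : Set} (d : Dec P) → does d ≡ true → P
  holds (yes p) _ = p

-- Finite undirected graphs.  Vertices and edges are drawn from Fin n and
-- Fin m, so that G, its spanning subgraphs and its vertex-deleted subgraphs
-- all live over the same names.  The order of the pair `ends e` carries no
-- meaning.  Loops and parallel edges are not excluded; a simple graph is the
-- special case in which they do not occur.
record Graph (n m : ℕ) : Set where
  field
    V      : Subset n
    E      : Subset m
    ends   : Fin m → Fin n × Fin n
    ends∈V : ∀ {e} → e ∈ E → proj₁ (ends e) ∈ V × proj₂ (ends e) ∈ V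

  Joins : Fin m → Fin n → Fin n → Set
  Joins e u v = ends e ≡ (u , v) ⊎ ends e ≡ (v , u)

  Within : Subset n → Fin m → Set
  Within S e = e ∈ E × proj₁ (ends e) ∈ S × proj₂ (ends e) ∈ S

  within? : ∀ S e → Dec (Within S e)
  within? S e = e ∈? E ×-dec proj₁ (ends e) ∈? S ×-dec proj₂ (ends e) ∈? S

  E[_] : Subset n → Subset m
  E[ S ] = tabulate λ e → does (within? S e)

  E[]-sound : ∀ {S e} → e ∈ E[ S ] → Within S e
  E[]-sound {S} {e} e∈ =
    holds (within? S e) (trans (sym (lookup∘tabulate _ e)) ([]=⇒lookup e∈))

open Graph

infixl 5 _-ᵍ_

_-ᵍ_ : Graph n m → Subset n → Graph n m
G -ᵍ F = record
  { V      = V G ─ F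
  ; E      = E[_] G (V G ─ F)
  ; ends   = ends G
  ; ends∈V = λ e∈ → proj₂ (E[]-sound G e∈)
  }

spanning : (G : Graph n m) (E′ : Subset m) → E′ ⊆ E G → Graph n m
spanning G E′ E′⊆E = record
  { V      = V G
  ; E      = E′
  ; ends   = ends G
  ; ends∈V = λ e∈ → ends∈V G (E′⊆E e∈)
  }

data Walk (G : Graph n m) : Fin n → Fin n → Set where
  stop : ∀ {v} → v ∈ V G → Walk G v v
  step : ∀ {u v w} (e : Fin m) → e ∈ E G → Joins G e u v → Walk G v w → Walk G u w

edges : {G : Graph n m} {u v : Fin n} → Walk G u v → List (Fin m)
edges (stop _)       = []
edges (step e _ _ p) = e ∷ edges p

-- All vertices visited except the final one, so that a closed walk lists its
-- base point once.
vertices : {G : Graph n m} {u v : Fin n} → Walk G u v → List (Fin n)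
vertices (stop _)               = []
vertices (step {u = u} _ _ _ p) = u ∷ vertices p

-- A loop is a cycle of length 1 and two parallel edges form a cycle of
-- length 2; in a simple graph distinctness of the edges forces length ≥ 3.
record Cycle (G : Graph n m) : Set where
  field
    {base}            : Fin n
    walk              : Walk G base base
    nonempty          : edges walk ≢ []
    distinct-edges    : Unique (edges walk)
    distinct-vertices : Unique (vertices walk)

open Cycle

-- Cycles are compared as subgraphs, i.e. by their edge sets: the base point
-- and the direction of traversal are immaterial.
SameCycle : {G : Graph n m} → Cycle G → Cycle G → Set
SameCycle c c′ = edges (walk c) ∼[ set ] edges (walk c′)

component : Graph n m → Fin n → Pred (Fin n) 0ℓ
component G v u = Walk G v u

AtMostOneCycleIn : Graph n m → Pred (Fin n) 0ℓ → Set
AtMostOneCycleIn G K = (c c′ : Cycle G) →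
  All K (vertices (walk c)) → All K (vertices (walk c′)) → SameCycle c c′

-- Every connected component is the component of some vertex.
IsPseudoforest : Graph n m → Set
IsPseudoforest G = ∀ v → v ∈ V G → AtMostOneCycleIn G (component G v)

-- The data (E, I) of a matroid; the matroid axioms are not recorded.
record SetSystem (m : ℕ) : Set₁ where
  field
    ground : Subset m
    Indep  : Pred (Subset m) 0ℓ

open SetSystem public

pseudoforestMatroid : Graph n m → SetSystem m
pseudoforestMatroid G = record
  { ground = E G
  ; Indep  = λ E′ → Σ (E′ ⊆ E G) λ E′⊆E → IsPseudoforest (spanning G E′ E′⊆E)
  }

record IsPartition {k : ℕ} (A : Subset m) (P : Fin k → Subset m) : Set where
  field
    part⊆    : ∀ i → P i ⊆ A
    covers   : ∀ {e} → e ∈ A → ∃ λ i → e ∈ P i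
    disjoint : ∀ {e i j} → e ∈ P i → e ∈ P j → i ≡ j

foldUnion : ℕ → SetSystem m → SetSystem m
foldUnion {m} ρ M = record
  { ground = ground M
  ; Indep  = λ A → A ⊆ ground M ×
      Σ (Fin ρ → Subset m) λ P → IsPartition A P × (∀ i → Indep M (P i))
  }

subsets : ∀ n → List (Subset n)
subsets zero    = [] ∷ []
subsets (suc n) = map (outside ∷_) (subsets n) ++ map (inside ∷_) (subsets n)

-- The value at denominator zero is never used: λ* ranges over nonempty sets.
ratio : ℕ → ℕ → ℚ
ratio p zero    = 0ℚ
ratio p (suc q) = + p / suc q

density : Graph n m → Subset n → ℚ
density G S = ratio ∣ E[_] G S ∣ ∣ S ∣

nonemptyVertexSets : Graph n m → List (Subset n)
nonemptyVertexSets {n} G = filter (λ S → nonempty? S ×-dec S ⊆? V G) (subsets n)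

-- Densities are nonnegative, so starting the maximum at 0 changes nothing when
-- V G is nonempty; when V G is empty it gives λ* G = 0, so λ* G ≤ ρ holds.
λ* : Graph n m → ℚ
λ* G = foldr _⊔_ 0ℚ (map (density G) (nonemptyVertexSets G))

{-# OPTIONS --safe #-}

-- Both conditions say that every edge can be charged to one of its ends so
-- that no vertex is charged more than ρ times.
--
-- In a pseudoforest, a tree grown from a vertex of S misses at most one edge
-- of the component it spans (two missed edges would close two different
-- cycles), so |E[S]| ≤ |S|; adding up over ρ parts bounds the density by ρ.
--
-- Conversely, give every vertex ρ slots and place the edges one after another
-- in distinct slots of their ends.  When no end of a new edge can be given a
-- free slot by moving earlier edges, the vertices that cannot be freed induce
-- more than ρ edges per vertex.  The edges in the i-th slots have distinct
-- tails; hence a cycle is consistently oriented and contains every edge whose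
-- tail lies on it, all arcs of its component lead to it, and there is no
-- second cycle in the component.

module Submission where

open import Defs
open import Data.Fin.Base using (Fin; zero; suc; fromℕ<)
open import Data.Fin.Properties using (_≟_; any?; suc-injective)
open import Data.Fin.Subset using (Subset; inside; outside; ⊥; _∈_; _∉_; _⊆_; _⊂_; _∪_; _─_; _-_; ⁅_⁆; ∣_∣; Nonempty)
open import Data.Fin.Subset.Induction using (⊂-wellFounded; ⊃-wellFounded; Acc; acc)
open import Data.Fin.Subset.Properties
open import Data.Integer.Base as ℤ using (+_)
open import Data.Integer.Properties as ℤ using ()
open import Data.List.Base using ([]; _∷_; foldr; map)
open import Data.List.Membership.Propositional using () renaming (_∈_ to _∈ˡ_; _∉_ to _∉ˡ_)
open import Data.List.Membership.Propositional.Properties using (∈-++⁺ˡ; ∈-++⁺ʳ; ∈-map⁺; ∈-filter⁺; ∈-filter⁻)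
open import Data.List.Relation.Unary.All as All using (All; []; _∷_)
open import Data.List.Relation.Unary.All.Properties using (All¬⇒¬Any; ¬Any⇒All¬)
open import Data.List.Relation.Unary.AllPairs as AllPairs using ([]; _∷_)
open import Data.List.Relation.Unary.Any as Any using (here; there)
open import Data.List.Relation.Unary.Unique.Propositional using (Unique)
open import Data.Nat.Base as ℕ using (ℕ; zero; suc; NonZero; z≤n; s≤s)
open import Data.Nat.Properties as ℕ using ()
open import Data.Product.Base using (∃; _×_; _,_; proj₁; proj₂)
open import Data.Product.Properties using (,-injectiveˡ; ≡-dec)
open import Data.Rational.Base using (ℚ; 0ℚ; _≤_; _/_; _⊔_)
open import Data.Rational.Properties using (toℚᵘ-fromℚᵘ; toℚᵘ-mono-≤; toℚᵘ-cancel-≤; ⊔-lub; p≤p⊔q; p≤q⊔p; ≤-trans)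
open import Data.Rational.Unnormalised.Base as ℚᵘ using (mkℚᵘ; *≤*)
open import Data.Rational.Unnormalised.Properties as ℚᵘ using ()
open import Data.Sum.Base using (_⊎_; inj₁; inj₂)
open import Data.Vec.Base using ([]; _∷_; tabulate; here; there)
open import Data.Vec.Functional using (updateAt)
open import Data.Vec.Functional.Properties using (updateAt-updates; updateAt-minimal)
open import Data.Vec.Properties using (lookup∘tabulate; []=⇒lookup; lookup⇒[]=)
open import Function.Base using (_∘_; const)
open import Function.Bundles using (Equivalence; _⇔_; mk⇔)
open import Relation.Binary.Construct.Closure.ReflexiveTransitive as Star using (Star; ε; _◅_; _◅◅_)
open import Relation.Binary.PropositionalEquality using (_≡_; _≢_; refl; sym; trans; cong; cong₂; subst; subst₂)
open import Relation.Nullary using (Dec; yes; no; does; ¬_; contradiction)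
open import Relation.Nullary.Decidable using (dec-true; _×-dec_; _⊎-dec_; ¬?)
open import Relation.Unary using (Decidable)

private
  variable
    n m k : ℕ

-- Finite subsets

comprehension : {P : Fin n → Set} → Decidable P → Subset n
comprehension P? = tabulate (does ∘ P?)

∈-comprehension⁺ : {P : Fin n → Set} (P? : Decidable P) → ∀ {x} → P x → x ∈ comprehension P?
∈-comprehension⁺ P? {x} Px =
  lookup⇒[]= x _ (trans (lookup∘tabulate _ x) (dec-true (P? x) Px))

∈-comprehension⁻ : {P : Fin n → Set} (P? : Decidable P) → ∀ {x} → x ∈ comprehension P? → P x
∈-comprehension⁻ P? {x} x∈ with P? x | trans (sym (lookup∘tabulate (does ∘ P?) x)) ([]=⇒lookup x∈)
... | yes Px | _ = Px
... | no _   | ()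

x∈p─q⇒x∉q : ∀ (p q : Subset n) {x} → x ∈ p ─ q → x ∉ q
x∈p─q⇒x∉q (_ ∷ p) (_ ∷ q) (there x∈) (there x∈q) = x∈p─q⇒x∉q p q x∈ x∈q

p⊂p∪⁅x⁆ : ∀ (p : Subset n) {x} → x ∉ p → p ⊂ p ∪ ⁅ x ⁆
p⊂p∪⁅x⁆ p {x} x∉p = p⊆p∪q ⁅ x ⁆ , x , q⊆p∪q p ⁅ x ⁆ (x∈⁅x⁆ x) , x∉p

y∈p∪⁅x⁆⁻ : ∀ (p : Subset n) {x y} → y ∈ p ∪ ⁅ x ⁆ → y ∈ p ⊎ y ≡ x
y∈p∪⁅x⁆⁻ p {x} y∈ with x∈p∪q⁻ p ⁅ x ⁆ y∈
... | inj₁ y∈p = inj₁ y∈p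
... | inj₂ y∈x = inj₂ (x∈⁅y⁆⇒x≡y x y∈x)

∣p∪q∣≤∣p∣+∣q∣ : ∀ (p q : Subset n) → ∣ p ∪ q ∣ ℕ.≤ ∣ p ∣ ℕ.+ ∣ q ∣
∣p∪q∣≤∣p∣+∣q∣ []            []            = z≤n
∣p∪q∣≤∣p∣+∣q∣ (outside ∷ p) (outside ∷ q) = ∣p∪q∣≤∣p∣+∣q∣ p q
∣p∪q∣≤∣p∣+∣q∣ (outside ∷ p) (inside ∷ q)  =
  ℕ.≤-trans (s≤s (∣p∪q∣≤∣p∣+∣q∣ p q)) (ℕ.≤-reflexive (sym (ℕ.+-suc ∣ p ∣ ∣ q ∣)))
∣p∪q∣≤∣p∣+∣q∣ (inside ∷ p)  (outside ∷ q) = s≤s (∣p∪q∣≤∣p∣+∣q∣ p q)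
∣p∪q∣≤∣p∣+∣q∣ (inside ∷ p)  (inside ∷ q)  =
  s≤s (ℕ.≤-trans (∣p∪q∣≤∣p∣+∣q∣ p q) (ℕ.+-monoʳ-≤ ∣ p ∣ (ℕ.n≤1+n ∣ q ∣)))

∣p∪⁅x⁆∣≤1+∣p∣ : ∀ (p : Subset n) x → ∣ p ∪ ⁅ x ⁆ ∣ ℕ.≤ suc ∣ p ∣
∣p∪⁅x⁆∣≤1+∣p∣ p x = begin
  ∣ p ∪ ⁅ x ⁆ ∣        ≤⟨ ∣p∪q∣≤∣p∣+∣q∣ p ⁅ x ⁆ ⟩
  ∣ p ∣ ℕ.+ ∣ ⁅ x ⁆ ∣  ≡⟨ cong (∣ p ∣ ℕ.+_) (∣⁅x⁆∣≡1 x) ⟩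
  ∣ p ∣ ℕ.+ 1          ≡⟨ ℕ.+-comm ∣ p ∣ 1 ⟩
  suc ∣ p ∣            ∎
  where open ℕ.≤-Reasoning

∣p∣+∣q─p∣≤∣q∣ : ∀ (p q : Subset n) → p ⊆ q → ∣ p ∣ ℕ.+ ∣ q ─ p ∣ ℕ.≤ ∣ q ∣
∣p∣+∣q─p∣≤∣q∣ []            []            _   = z≤n
∣p∣+∣q─p∣≤∣q∣ (outside ∷ p) (outside ∷ q) p⊆q = ∣p∣+∣q─p∣≤∣q∣ p q (drop-∷-⊆ p⊆q)
∣p∣+∣q─p∣≤∣q∣ (outside ∷ p) (inside ∷ q)  p⊆q =
  ℕ.≤-trans (ℕ.≤-reflexive (ℕ.+-suc ∣ p ∣ _)) (s≤s (∣p∣+∣q─p∣≤∣q∣ p q (drop-∷-⊆ p⊆q)))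
∣p∣+∣q─p∣≤∣q∣ (inside ∷ p)  (inside ∷ q)  p⊆q = s≤s (∣p∣+∣q─p∣≤∣q∣ p q (drop-∷-⊆ p⊆q))
∣p∣+∣q─p∣≤∣q∣ (inside ∷ p)  (outside ∷ q) p⊆q with () ← p⊆q here

injectiveOn⇒∣p∣≤∣q∣ : ∀ (p : Subset n) (q : Subset m) (g : Fin n → Fin m) →
  (∀ {x} → x ∈ p → g x ∈ q) →
  (∀ {x y} → x ∈ p → y ∈ p → g x ≡ g y → x ≡ y) → ∣ p ∣ ℕ.≤ ∣ q ∣
injectiveOn⇒∣p∣≤∣q∣ []            q g g∈q inj = z≤n
injectiveOn⇒∣p∣≤∣q∣ (outside ∷ p) q g g∈q inj =
  injectiveOn⇒∣p∣≤∣q∣ p q (g ∘ suc) (g∈q ∘ there)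
    λ x∈ y∈ eq → suc-injective (inj (there x∈) (there y∈) eq)
injectiveOn⇒∣p∣≤∣q∣ (inside ∷ p)  q g g∈q inj = ℕ.≤-<-trans
  (injectiveOn⇒∣p∣≤∣q∣ p (q - g zero) (g ∘ suc)
    (λ x∈ → x∈p∧x≢y⇒x∈p-y (g∈q (there x∈)) λ eq → contradiction (inj (there x∈) here eq) λ ())
    λ x∈ y∈ eq → suc-injective (inj (there x∈) (there y∈) eq))
  (x∈p⇒∣p-x∣<∣p∣ (g∈q here))

-- Peeling off `P zero` leaves a set covered by the remaining parts. This adds up the bounds for the
-- `ρ` pseudoforests.
cover⇒∣q∣≤k*s : ∀ {s} (P : Fin k → Subset n) (q : Subset n) →
  (∀ {x} → x ∈ q → ∃ λ i → x ∈ P i) → (∀ i → ∣ P i ∣ ℕ.≤ s) → ∣ q ∣ ℕ.≤ k ℕ.* s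
cover⇒∣q∣≤k*s {k = zero} {n = n} P q covers _ with nonempty? q
... | yes (x , x∈q) with () ← proj₁ (covers x∈q)
... | no q-empty = ℕ.≤-reflexive (trans (cong ∣_∣ (Empty-unique q-empty)) (∣⊥∣≡0 n))
cover⇒∣q∣≤k*s {k = suc k} {s = s} P q covers bound = begin
  ∣ q ∣                               ≤⟨ p⊆q⇒∣p∣≤∣q∣ split ⟩
  ∣ P zero ∪ (q ─ P zero) ∣           ≤⟨ ∣p∪q∣≤∣p∣+∣q∣ (P zero) _ ⟩
  ∣ P zero ∣ ℕ.+ ∣ q ─ P zero ∣       ≤⟨ ℕ.+-mono-≤ (bound zero)
                                          (cover⇒∣q∣≤k*s (P ∘ suc) _ covers′ (bound ∘ suc)) ⟩
  s ℕ.+ k ℕ.* s                       ∎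
  where
  open ℕ.≤-Reasoning
  split : q ⊆ P zero ∪ (q ─ P zero)
  split {x} x∈q with x ∈? P zero
  ... | yes x∈P = p⊆p∪q _ x∈P
  ... | no  x∉P = q⊆p∪q (P zero) _ (x∈p∧x∉q⇒x∈p─q x∈q x∉P)
  covers′ : ∀ {x} → x ∈ q ─ P zero → ∃ λ i → x ∈ P (suc i)
  covers′ x∈ with covers (p─q⊆p q (P zero) x∈)
  ... | zero  , x∈P = contradiction x∈P (x∈p─q⇒x∉q q (P zero) x∈)
  ... | suc i , x∈P = i , x∈P

-- Disjointness keeps the later parts inside `q ─ P zero`. In `stuck⇒dense` the parts are the edges
-- sorted by slot index.
packing⇒k*s≤∣q∣ : ∀ {s} (P : Fin k → Subset n) (q : Subset n) →
  (∀ i → P i ⊆ q) → (∀ {x i j} → x ∈ P i → x ∈ P j → i ≡ j) →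
  (∀ i → s ℕ.≤ ∣ P i ∣) → k ℕ.* s ℕ.≤ ∣ q ∣
packing⇒k*s≤∣q∣ {k = zero}  P q _ _ _ = z≤n
packing⇒k*s≤∣q∣ {k = suc k} P q P⊆q disjoint bound = ℕ.≤-trans
  (ℕ.+-mono-≤ (bound zero) (packing⇒k*s≤∣q∣ (P ∘ suc) (q ─ P zero)
    (λ i x∈ → x∈p∧x∉q⇒x∈p─q (P⊆q (suc i) x∈) λ x∈₀ → contradiction (disjoint x∈ x∈₀) λ ())
    (λ x∈ x∈′ → suc-injective (disjoint x∈ x∈′))
    (bound ∘ suc)))
  (∣p∣+∣q─p∣≤∣q∣ (P zero) q (P⊆q zero))

-- Each growth step is strict, so it can be repeated only finitely often. The same search builds
-- trees, sets of freeable vertices and assignments; only `P` and `Closed` change.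
saturate : (P : Subset n → Set) {Closed : Subset n → Set} →
  (∀ p → P p → Closed p ⊎ ∃ λ x → x ∉ p × P (p ∪ ⁅ x ⁆)) →
  ∀ p → P p → ∃ λ q → P q × Closed q
saturate P {Closed} grow p = go p (⊃-wellFounded p)
  where
  go : ∀ p → Acc _ p → P p → ∃ λ q → P q × Closed q
  go p (acc rec) Pp with grow p Pp
  ... | inj₁ closed           = p , Pp , closed
  ... | inj₂ (x , x∉p , Pp∪x) = go _ (rec (p⊂p∪⁅x⁆ p x∉p)) Pp∪x

∉⇒All≢ : ∀ {x : Fin n} {xs} → x ∉ˡ xs → All (x ≢_) xs
∉⇒All≢ = ¬Any⇒All¬ _

-- Pseudoforests are sparse

module _ (G : Graph n m) where
  open Graph G

  joins-sym : ∀ {e u v} → Joins e u v → Joins e v u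
  joins-sym (inj₁ eq) = inj₂ eq
  joins-sym (inj₂ eq) = inj₁ eq

  joins-end : ∀ {e a b u v} → Joins e a b → Joins e u v → u ≡ a ⊎ u ≡ b
  joins-end (inj₁ refl) (inj₁ refl) = inj₁ refl
  joins-end (inj₁ refl) (inj₂ refl) = inj₂ refl
  joins-end (inj₂ refl) (inj₁ refl) = inj₂ refl
  joins-end (inj₂ refl) (inj₂ refl) = inj₁ refl

  joins∈V : ∀ {e u v} → e ∈ E → Joins e u v → v ∈ V
  joins∈V e∈E (inj₁ refl) = proj₂ (ends∈V e∈E)
  joins∈V e∈E (inj₂ refl) = proj₁ (ends∈V e∈E)

  E[]-complete : ∀ {S e} → Within S e → e ∈ E[ S ]
  E[]-complete {S} = ∈-comprehension⁺ (within? S)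

  start-visited : ∀ {u w} (p : Walk G u w) → u ∈ˡ vertices p ⊎ u ≡ w
  start-visited (stop _)       = inj₂ refl
  start-visited (step _ _ _ _) = inj₁ (here refl)

  -- The second alternative arises because `vertices` omits the last vertex of a walk.
  edge-end-visited : ∀ {a w e u v} (p : Walk G a w) → e ∈ˡ edges p → Joins e u v →
    u ∈ˡ vertices p ⊎ u ≡ w
  edge-end-visited (step _ _ j p) (here refl) j′ with joins-end j j′
  ... | inj₁ refl = inj₁ (here refl)
  ... | inj₂ refl with start-visited p
  ...   | inj₁ v∈p = inj₁ (there v∈p)
  ...   | inj₂ v≡w = inj₂ v≡w
  edge-end-visited (step _ _ _ p) (there e∈p) j′ with edge-end-visited p e∈p j′
  ... | inj₁ u∈p = inj₁ (there u∈p)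
  ... | inj₂ u≡w = inj₂ u≡w

  snoc : ∀ {r a b e} → Walk G r a → e ∈ E → Joins e a b → Walk G r b
  snoc (stop _)        e∈E j = step _ e∈E j (stop (joins∈V e∈E j))
  snoc (step f f∈E i p) e∈E j = step f f∈E i (snoc p e∈E j)

  all-reachable : ∀ {r a b} → Walk G r a → (p : Walk G a b) → All (Walk G r) (vertices p)
  all-reachable r⇝a (stop _)         = []
  all-reachable r⇝a (step _ e∈E j p) = r⇝a ∷ all-reachable (snoc r⇝a e∈E j) p

  -- Simple paths and fundamental cycles

  Adjacent : Subset m → Fin n → Fin n → Set
  Adjacent T u v = ∃ λ e → e ∈ T × Joins e u v

  record IsSimplePath (T : Subset m) {u w} (p : Walk G u w) : Set where
    field
      edges⊆T         : All (_∈ T) (edges p)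
      unique-edges    : Unique (edges p)
      unique-vertices : Unique (vertices p)
      end-fresh       : w ∉ˡ vertices p

  open IsSimplePath

  tail-simple : ∀ {T u v w e e∈E j} {p : Walk G v w} →
    IsSimplePath T (step {u = u} e e∈E j p) → IsSimplePath T p
  tail-simple s = record
    { edges⊆T         = All.tail (edges⊆T s)
    ; unique-edges    = AllPairs.tail (unique-edges s)
    ; unique-vertices = AllPairs.tail (unique-vertices s)
    ; end-fresh       = end-fresh s ∘ there
    }

  suffix : ∀ {T u w x} (p : Walk G u w) → IsSimplePath T p → x ∈ˡ vertices p →
    ∃ λ (q : Walk G x w) → IsSimplePath T q
  suffix p@(step _ _ _ _) s (here refl) = p , s
  suffix (step _ _ _ p)   s (there x∈p) = suffix p (tail-simple s) x∈p

  module _ {T : Subset m} (T⊆E : T ⊆ E) where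

    toWalk : ∀ {u w} → w ∈ V → Star (Adjacent T) u w → Walk G u w
    toWalk w∈V ε                    = stop w∈V
    toWalk w∈V ((e , e∈T , j) ◅ p) = step e (T⊆E e∈T) j (toWalk w∈V p)

    -- An edge is prepended only if its start `u` is new. If `u` already lies on the path,
    -- everything before that visit is dropped; if `u` is the end, the empty path remains. A new `u`
    -- makes the edge new as well, since the ends of all edges of the path are visited.
    loop-erase : ∀ {u w} → w ∈ V → Star (Adjacent T) u w →
      ∃ λ (p : Walk G u w) → IsSimplePath T p
    loop-erase w∈V ε = stop w∈V , record
      { edges⊆T = [] ; unique-edges = [] ; unique-vertices = [] ; end-fresh = λ () }
    loop-erase {u} {w} w∈V ((e , e∈T , j) ◅ q) with loop-erase w∈V q
    ... | p , s with Any.any? (u ≟_) (vertices p) | u ≟ w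
    ...   | yes u∈p | _        = suffix p s u∈p
    ...   | no _    | yes refl = stop w∈V , record
      { edges⊆T = [] ; unique-edges = [] ; unique-vertices = [] ; end-fresh = λ () }
    ...   | no u∉p  | no u≢w   = step e (T⊆E e∈T) j p , record
      { edges⊆T         = e∈T ∷ edges⊆T s
      ; unique-edges    = ∉⇒All≢ e∉p ∷ unique-edges s
      ; unique-vertices = ∉⇒All≢ u∉p ∷ unique-vertices s
      ; end-fresh       = λ { (here w≡u) → u≢w (sym w≡u) ; (there w∈p) → end-fresh s w∈p }
      }
      where
      e∉p : e ∉ˡ edges p
      e∉p e∈p with edge-end-visited p e∈p j
      ... | inj₁ u∈p = u∉p u∈p
      ... | inj₂ u≡w = u≢w u≡w

    -- The walk in `T` from `v` through the root to `u` is made simple, and `e` closes it; for a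
    -- loop the path is empty. The last conclusion tells apart the cycles of different edges outside
    -- `T`.
    fundamental-cycle : ∀ {r e u v} → e ∈ E → e ∉ T → Joins e u v →
      Star (Adjacent T) r u → Star (Adjacent T) r v →
      ∃ λ (c : Cycle G) → All (component G r) (vertices (Cycle.walk c)) ×
        e ∈ˡ edges (Cycle.walk c) × (∀ {f} → f ∈ˡ edges (Cycle.walk c) → f ∉ T → f ≡ e)
    fundamental-cycle {e = e} {u} {v} e∈E e∉T j r⇝u r⇝v
      with loop-erase (joins∈V e∈E (joins-sym j)) (Star.reverse flip-adjacent r⇝v ◅◅ r⇝u)
      where
      flip-adjacent : ∀ {a b} → Adjacent T a b → Adjacent T b a
      flip-adjacent (f , f∈T , i) = f , f∈T , joins-sym i
    ... | p , s = cycle , all-reachable (toWalk (joins∈V e∈E (joins-sym j)) r⇝u) cwalk , here refl , only-e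
      where
      cwalk : Walk G u u
      cwalk = step e e∈E j p
      cycle : Cycle G
      cycle = record
        { walk              = cwalk
        ; nonempty          = λ ()
        ; distinct-edges    = ∉⇒All≢ (λ e∈p → e∉T (All.lookup (edges⊆T s) e∈p)) ∷ unique-edges s
        ; distinct-vertices = ∉⇒All≢ (end-fresh s) ∷ unique-vertices s
        }
      only-e : ∀ {f} → f ∈ˡ edges cwalk → f ∉ T → f ≡ e
      only-e (here f≡e)  _   = f≡e
      only-e (there f∈p) f∉T = contradiction (All.lookup (edges⊆T s) f∈p) f∉T

  -- Trees grown inside a vertex set

  record Tree (S : Subset n) (r : Fin n) (K : Subset n) : Set where
    field
      T     : Subset m
      T⊆E   : T ⊆ E
      r∈K   : r ∈ K
      K⊆S   : K ⊆ S
      reach : ∀ {x} → x ∈ K → Star (Adjacent T) r x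
      -- Acyclicity is recorded as a count: together with `reach` it makes `T` a spanning tree of
      -- `K`, and its strictness leaves room for one more edge.
      ∣T∣<∣K∣ : ∣ T ∣ ℕ.< ∣ K ∣

  Leaves : Subset n → Subset n → Fin m → Set
  Leaves S K e = Within S e ×
    ((proj₁ (ends e) ∈ K × proj₂ (ends e) ∉ K) ⊎ (proj₂ (ends e) ∈ K × proj₁ (ends e) ∉ K))

  leaves? : ∀ S K → Decidable (Leaves S K)
  leaves? S K e = within? S e ×-dec
    ((proj₁ (ends e) ∈? K ×-dec ¬? (proj₂ (ends e) ∈? K)) ⊎-dec
     (proj₂ (ends e) ∈? K ×-dec ¬? (proj₁ (ends e) ∈? K)))

  singleton-tree : ∀ {S r} → r ∈ S → Tree S r ⁅ r ⁆
  singleton-tree {S} {r} r∈S = record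
    { T     = ⊥
    ; T⊆E   = λ x∈⊥ → contradiction x∈⊥ ∉⊥
    ; r∈K   = x∈⁅x⁆ r
    ; K⊆S   = λ x∈ → subst (_∈ S) (sym (x∈⁅y⁆⇒x≡y r x∈)) r∈S
    ; reach = λ x∈ → subst (Star _ r) (sym (x∈⁅y⁆⇒x≡y r x∈)) ε
    ; ∣T∣<∣K∣ = ℕ.≤-reflexive (trans (cong suc (∣⊥∣≡0 m)) (sym (∣⁅x⁆∣≡1 r)))
    }

  add-leaf : ∀ {S r K e x y} → Tree S r K → e ∈ E → Joins e x y → x ∈ K → y ∈ S → y ∉ K →
    Tree S r (K ∪ ⁅ y ⁆)
  add-leaf {S} {r} {K} {e} {x} {y} tree e∈E j x∈K y∈S y∉K = record
    { T     = T ∪ ⁅ e ⁆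
    ; T⊆E   = T∪e⊆E
    ; r∈K   = p⊆p∪q _ r∈K
    ; K⊆S   = K∪y⊆S
    ; reach = reach′
    ; ∣T∣<∣K∣ = ℕ.≤-<-trans (∣p∪⁅x⁆∣≤1+∣p∣ T e)
        (ℕ.≤-<-trans ∣T∣<∣K∣ (p⊂q⇒∣p∣<∣q∣ (p⊂p∪⁅x⁆ K y∉K)))
    }
    where
    open Tree tree
    T∪e⊆E : T ∪ ⁅ e ⁆ ⊆ E
    T∪e⊆E f∈ with y∈p∪⁅x⁆⁻ T f∈
    ... | inj₁ f∈T  = T⊆E f∈T
    ... | inj₂ refl = e∈E
    K∪y⊆S : K ∪ ⁅ y ⁆ ⊆ S
    K∪y⊆S z∈ with y∈p∪⁅x⁆⁻ K z∈
    ... | inj₁ z∈K  = K⊆S z∈K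
    ... | inj₂ refl = y∈S
    widen : ∀ {z} → z ∈ K → Star (Adjacent (T ∪ ⁅ e ⁆)) r z
    widen z∈K = Star.map (λ { (f , f∈T , i) → f , p⊆p∪q _ f∈T , i }) (reach z∈K)
    reach′ : ∀ {z} → z ∈ K ∪ ⁅ y ⁆ → Star (Adjacent (T ∪ ⁅ e ⁆)) r z
    reach′ z∈ with y∈p∪⁅x⁆⁻ K z∈
    ... | inj₁ z∈K  = widen z∈K
    ... | inj₂ refl = widen x∈K ◅◅ (e , q⊆p∪q T _ (x∈⁅x⁆ e) , j) ◅ ε

  -- Once no edge of `E[ S ]` leaves `K`, the tree spans the component of `r` in the subgraph
  -- induced on `S`.
  spanning-tree : ∀ {S r} → r ∈ S → ∃ λ K → Tree S r K × ¬ ∃ (Leaves S K)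
  spanning-tree {S} {r} r∈S = saturate (Tree S r) grow ⁅ r ⁆ (singleton-tree r∈S)
    where
    grow : ∀ K → Tree S r K → ¬ ∃ (Leaves S K) ⊎ ∃ λ x → x ∉ K × Tree S r (K ∪ ⁅ x ⁆)
    grow K tree with any? (leaves? S K)
    ... | no closed = inj₁ closed
    ... | yes (e , (e∈E , _ , v∈S) , inj₁ (u∈K , v∉K)) =
      inj₂ (_ , v∉K , add-leaf tree e∈E (inj₁ refl) u∈K v∈S v∉K)
    ... | yes (e , (e∈E , u∈S , _) , inj₂ (v∈K , u∉K)) =
      inj₂ (_ , u∉K , add-leaf tree e∈E (inj₂ refl) v∈K u∈S u∉K)

  -- Two edges of E[ K ] outside the tree would close two distinct cycles in
  -- the component of the root.
  ∣E[tree]∣≤∣K∣ : IsPseudoforest G → ∀ {S r K} → S ⊆ V → Tree S r K → ∣ E[ K ] ∣ ℕ.≤ ∣ K ∣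
  ∣E[tree]∣≤∣K∣ pseudoforest {S} {r} {K} S⊆V tree with nonempty? (E[ K ] ─ T)
    where open Tree tree
  ... | no empty = ℕ.≤-trans (p⊆q⇒∣p∣≤∣q∣ E[K]⊆T) (ℕ.<⇒≤ ∣T∣<∣K∣)
    where
    open Tree tree
    E[K]⊆T : E[ K ] ⊆ T
    E[K]⊆T {e} e∈ with e ∈? T
    ... | yes e∈T = e∈T
    ... | no  e∉T = contradiction (e , x∈p∧x∉q⇒x∈p─q e∈ e∉T) empty
  ... | yes (e , e∈) = ℕ.≤-trans (p⊆q⇒∣p∣≤∣q∣ E[K]⊆T∪e)
      (ℕ.≤-trans (∣p∪⁅x⁆∣≤1+∣p∣ T e) ∣T∣<∣K∣)
    where
    open Tree tree
    r∈V : r ∈ V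
    r∈V = S⊆V (K⊆S r∈K)
    e∉T : e ∉ T
    e∉T = x∈p─q⇒x∉q E[ K ] T e∈
    cycle-through : ∀ {f} → f ∈ E[ K ] → f ∉ T → _
    cycle-through f∈ f∉T with f∈E , u∈K , v∈K ← E[]-sound f∈ =
      fundamental-cycle T⊆E f∈E f∉T (inj₁ refl) (reach u∈K) (reach v∈K)
    E[K]⊆T∪e : E[ K ] ⊆ T ∪ ⁅ e ⁆
    E[K]⊆T∪e {f} f∈ with f ∈? T
    ... | yes f∈T = p⊆p∪q _ f∈T
    ... | no  f∉T with cycle-through (p─q⊆p E[ K ] T e∈) e∉T | cycle-through f∈ f∉T
    ...   | c , c-in , e∈c , only-e | c′ , c′-in , f∈c′ , _
      with refl ← only-e (Equivalence.from (pseudoforest r r∈V c c′ c-in c′-in) f∈c′) f∉T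
      = q⊆p∪q T _ (x∈⁅x⁆ e)

  -- Induction on `S`: a component `K` of the induced subgraph is split off. No edge runs between
  -- `K` and `S ─ K`, so the two bounds add up.
  pseudoforest⇒∣E[S]∣≤∣S∣ : IsPseudoforest G → ∀ S → S ⊆ V → ∣ E[ S ] ∣ ℕ.≤ ∣ S ∣
  pseudoforest⇒∣E[S]∣≤∣S∣ pseudoforest S = go S (⊂-wellFounded S)
    where
    go : ∀ S → Acc _⊂_ S → S ⊆ V → ∣ E[ S ] ∣ ℕ.≤ ∣ S ∣
    go S (acc rec) S⊆V with nonempty? S
    ... | no empty = ℕ.≤-trans (p⊆q⇒∣p∣≤∣q∣ E[S]⊆⊥) (ℕ.≤-trans (ℕ.≤-reflexive (∣⊥∣≡0 m)) z≤n)
      where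
      E[S]⊆⊥ : E[ S ] ⊆ ⊥
      E[S]⊆⊥ e∈ = contradiction (_ , proj₁ (proj₂ (E[]-sound e∈))) empty
    ... | yes (r , r∈S) with spanning-tree r∈S
    ...   | K , tree , closed = begin
      ∣ E[ S ] ∣                        ≤⟨ p⊆q⇒∣p∣≤∣q∣ split ⟩
      ∣ E[ K ] ∪ E[ S ─ K ] ∣           ≤⟨ ∣p∪q∣≤∣p∣+∣q∣ E[ K ] _ ⟩
      ∣ E[ K ] ∣ ℕ.+ ∣ E[ S ─ K ] ∣     ≤⟨ ℕ.+-mono-≤ (∣E[tree]∣≤∣K∣ pseudoforest S⊆V tree)
                                            (go (S ─ K) (rec S─K⊂S) (S⊆V ∘ p─q⊆p S K)) ⟩
      ∣ K ∣ ℕ.+ ∣ S ─ K ∣               ≤⟨ ∣p∣+∣q─p∣≤∣q∣ K S K⊆S ⟩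
      ∣ S ∣                             ∎
      where
      open ℕ.≤-Reasoning
      open Tree tree
      S─K⊂S : S ─ K ⊂ S
      S─K⊂S = p─q⊆p S K , r , r∈S , λ r∈ → x∈p─q⇒x∉q S K r∈ r∈K
      split : E[ S ] ⊆ E[ K ] ∪ E[ S ─ K ]
      split {e} e∈ with e∈E , u∈S , v∈S ← E[]-sound e∈
        with proj₁ (ends e) ∈? K | proj₂ (ends e) ∈? K
      ... | yes u∈K | yes v∈K = p⊆p∪q _ (E[]-complete (e∈E , u∈K , v∈K))
      ... | yes u∈K | no  v∉K = contradiction (e , (e∈E , u∈S , v∈S) , inj₁ (u∈K , v∉K)) closed
      ... | no  u∉K | yes v∈K = contradiction (e , (e∈E , u∈S , v∈S) , inj₂ (v∈K , u∉K)) closed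
      ... | no  u∉K | no  v∉K = q⊆p∪q E[ K ] _
        (E[]-complete (e∈E , x∈p∧x∉q⇒x∈p─q u∈S u∉K , x∈p∧x∉q⇒x∈p─q v∈S v∉K))

-- Pseudoforests from injective choices of endpoints

  joins-other : ∀ {e u v w} → Joins e u v → Joins e u w → w ≡ v
  joins-other (inj₁ refl) (inj₁ refl) = refl
  joins-other (inj₁ p)    (inj₂ q)    with refl ← trans (sym p) q = refl
  joins-other (inj₂ p)    (inj₁ q)    with refl ← trans (sym p) q = refl
  joins-other (inj₂ refl) (inj₂ refl) = refl

  reverse : ∀ {u v} → Walk G u v → Walk G v u
  reverse (stop v∈V)       = stop v∈V
  reverse (step _ e∈E j p) = snoc (reverse p) e∈E (joins-sym j)

  IsEnd : Fin n → Fin m → Set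
  IsEnd x e = x ≡ proj₁ (ends e) ⊎ x ≡ proj₂ (ends e)

  -- With every edge directed away from its `tail`, injectivity says that at most one arc leaves
  -- each vertex.
  module _ (tail : Fin m → Fin n)
           (tail-end : ∀ {e} → e ∈ E → IsEnd (tail e) e)
           (tail-injective : ∀ {e f} → e ∈ E → f ∈ E → tail e ≡ tail f → e ≡ f) where

    tail-joins : ∀ {e u v} → e ∈ E → Joins e u v → tail e ≡ u ⊎ tail e ≡ v
    tail-joins e∈E j with tail-end e∈E | j
    ... | inj₁ eq | inj₁ refl = inj₁ eq
    ... | inj₁ eq | inj₂ refl = inj₂ eq
    ... | inj₂ eq | inj₁ refl = inj₂ eq
    ... | inj₂ eq | inj₂ refl = inj₁ eq

    data Forward : ∀ {u w} → Walk G u w → Set where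
      stop : ∀ {v v∈V} → Forward (stop {v = v} v∈V)
      step : ∀ {u v w e e∈E j} {p : Walk G v w} → tail e ≡ u → Forward p →
             Forward (step {u = u} e e∈E j p)

    data Backward : ∀ {u w} → Walk G u w → Set where
      stop : ∀ {v v∈V} → Backward (stop {v = v} v∈V)
      step : ∀ {u v w e e∈E j} {p : Walk G v w} → tail e ≡ v → Backward p →
             Backward (step {u = u} e e∈E j p)

    -- `e` lies outside `p` and already has tail `v`, so the first edge of `p` has its tail at its
    -- far end. That edge then takes the role of `e`.
    backward : ∀ {e v w} (p : Walk G v w) → Unique (edges p) → e ∈ E → e ∉ˡ edges p →
      tail e ≡ v → Backward p
    backward (stop _) _ _ _ _ = stop
    backward (step f f∈E j p) (f∉p ∷ unique) e∈E e∉ eq with tail-joins f∈E j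
    ... | inj₁ eq′ = contradiction (here (tail-injective e∈E f∈E (trans eq (sym eq′)))) e∉
    ... | inj₂ eq′ = step eq′ (backward p unique f∈E (All¬⇒¬Any f∉p) eq′)

    -- The mirror image, settled from the far end: `e` occupies `w`, so the last edge has its tail
    -- at its near end, and every earlier edge finds its far end occupied by its successor.
    forward : ∀ {e v w} (p : Walk G v w) → Unique (edges p) → e ∈ E → e ∉ˡ edges p →
      tail e ≡ w → Forward p
    forward (stop _) _ _ _ _ = stop
    forward (step f f∈E j p) (f∉p ∷ unique) e∈E e∉ eq
      with tail-joins f∈E j | forward p unique e∈E (e∉ ∘ there) eq
    ... | inj₁ eq′ | fwd  = step eq′ fwd
    ... | inj₂ eq′ | stop = contradiction (here (tail-injective e∈E f∈E (trans eq (sym eq′)))) e∉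
    ... | inj₂ eq′ | step {e = g} {e∈E = g∈E} eq″ _ =
      contradiction (here (tail-injective f∈E g∈E (trans eq′ (sym eq″)))) (All¬⇒¬Any f∉p)

    -- The first edge serves as the arc outside the rest. Its tail is either the end of the rest,
    -- which forces forward, or the start of the rest, which forces backward.
    oriented : ∀ {u} (p : Walk G u u) → Unique (edges p) → Forward p ⊎ Backward p
    oriented (stop _) _ = inj₁ stop
    oriented (step e e∈E j p) (e∉p ∷ unique) with tail-joins e∈E j
    ... | inj₁ eq = inj₁ (step eq (forward p unique e∈E (All¬⇒¬Any e∉p) eq))
    ... | inj₂ eq = inj₂ (step eq (backward p unique e∈E (All¬⇒¬Any e∉p) eq))

    forward-out : ∀ {u w x} {p : Walk G u w} → Forward p → x ∈ˡ vertices p →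
      ∃ λ e → e ∈ˡ edges p × e ∈ E × tail e ≡ x
    forward-out (step {e∈E = e∈E} eq fwd) (here refl) = _ , here refl , e∈E , eq
    forward-out (step eq fwd) (there x∈p) with e , e∈p , rest ← forward-out fwd x∈p =
      e , there e∈p , rest

    -- On a backward walk the arc out of a vertex is the edge traversed just before it. The start
    -- has no such edge; on a closed walk `backward-out-end` supplies the last one.
    backward-out : ∀ {u w x} {p : Walk G u w} → Backward p → x ∈ˡ vertices p →
      x ≡ u ⊎ ∃ λ e → e ∈ˡ edges p × e ∈ E × tail e ≡ x
    backward-out (step eq bwd) (here refl) = inj₁ refl
    backward-out (step {e∈E = e∈E} eq bwd) (there x∈p) with backward-out bwd x∈p
    ... | inj₁ refl = inj₂ (_ , here refl , e∈E , eq)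
    ... | inj₂ (e , e∈p , rest) = inj₂ (e , there e∈p , rest)

    backward-out-end : ∀ {u w} {p : Walk G u w} → Backward p → edges p ≢ [] →
      ∃ λ e → e ∈ˡ edges p × e ∈ E × tail e ≡ w
    backward-out-end stop nonempty = contradiction refl nonempty
    backward-out-end (step {e∈E = e∈E} eq stop) _ = _ , here refl , e∈E , eq
    backward-out-end (step _ bwd@(step _ _)) _ with e , e∈p , rest ← backward-out-end bwd (λ ()) =
      e , there e∈p , rest

    -- Arcs cannot leave a cycle

    module _ (c : Cycle G) where
      open Cycle c

      base-visited : base ∈ˡ vertices walk
      base-visited with walk | nonempty
      ... | stop _       | ne = contradiction refl ne
      ... | step _ _ _ _ | _  = here refl

      cycle-out : ∀ {x} → x ∈ˡ vertices walk → ∃ λ e → e ∈ˡ edges walk × e ∈ E × tail e ≡ x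
      cycle-out x∈c with oriented walk distinct-edges
      ... | inj₁ fwd = forward-out fwd x∈c
      ... | inj₂ bwd with backward-out bwd x∈c
      ...   | inj₁ refl = backward-out-end bwd nonempty
      ...   | inj₂ out  = out

      -- By `cycle-out` the cycle already uses an arc out of `x`, and there is no second one.
      cycle-absorbs : ∀ {x e} → x ∈ˡ vertices walk → e ∈ E → tail e ≡ x → e ∈ˡ edges walk
      cycle-absorbs x∈c e∈E eq with f , f∈c , f∈E , eq′ ← cycle-out x∈c
        with refl ← tail-injective e∈E f∈E (trans eq (sym eq′)) = f∈c

      cycle-closed : ∀ {x y e} → x ∈ˡ vertices walk → e ∈ E → tail e ≡ x → Joins e x y →
        y ∈ˡ vertices walk
      cycle-closed x∈c e∈E eq j
        with edge-end-visited walk (cycle-absorbs x∈c e∈E eq) (joins-sym j)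
      ... | inj₁ y∈c  = y∈c
      ... | inj₂ refl = base-visited

      forward-from : ∀ {u w} {p : Walk G u w} → Forward p → u ∈ˡ vertices walk →
        All (_∈ˡ edges walk) (edges p) × w ∈ˡ vertices walk
      forward-from stop u∈c = [] , u∈c
      forward-from (step {e∈E = e∈E} {j} eq fwd) u∈c
        with all , w∈c ← forward-from fwd (cycle-closed u∈c e∈E eq j) =
        cycle-absorbs u∈c e∈E eq ∷ all , w∈c

      forward-end : ∀ {u w z} {p : Walk G u w} → Forward p → z ∈ˡ vertices p →
        z ∈ˡ vertices walk → w ∈ˡ vertices walk
      forward-end fwd@(step _ _) (here refl) z∈c = proj₂ (forward-from fwd z∈c)
      forward-end (step _ fwd)   (there z∈p) z∈c = forward-end fwd z∈p z∈c

      backward-from : ∀ {u w} {p : Walk G u w} → Backward p → w ∈ˡ vertices walk →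
        All (_∈ˡ edges walk) (edges p) × u ∈ˡ vertices walk
      backward-from stop w∈c = [] , w∈c
      backward-from (step {e∈E = e∈E} {j} eq bwd) w∈c with all , v∈c ← backward-from bwd w∈c =
        cycle-absorbs v∈c e∈E eq ∷ all , cycle-closed v∈c e∈E eq (joins-sym j)

      backward-start : ∀ {u w z} {p : Walk G u w} → Backward p → z ∈ˡ vertices p →
        z ∈ˡ vertices walk → u ∈ˡ vertices walk
      backward-start (step _ _) (here refl) z∈c = z∈c
      backward-start (step {e∈E = e∈E} {j} eq bwd) (there z∈p) z∈c =
        cycle-closed (backward-start bwd z∈p z∈c) e∈E eq (joins-sym j)

      Arc : Fin n → Fin n → Set
      Arc x y = ∃ λ e → e ∈ E × Joins e x y × tail e ≡ x

      -- Stated with arcs because directed routes, unlike walks, cannot leave a cycle.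
      Reaches : Fin n → Set
      Reaches x = ∃ λ y → y ∈ˡ vertices walk × Star Arc x y

      -- A vertex has only one outgoing arc, so stepping along it either
      -- shortens the route to the cycle or stays on the cycle.
      reaches-step : ∀ {e u v} → e ∈ E → Joins e u v → Reaches u → Reaches v
      reaches-step e∈E j (y , y∈c , route) with tail-joins e∈E j
      ... | inj₂ eq = y , y∈c , (_ , e∈E , joins-sym j , eq) ◅ route
      reaches-step e∈E j (y , y∈c , ε) | inj₁ eq = _ , cycle-closed y∈c e∈E eq j , ε
      reaches-step e∈E j (y , y∈c , (f , f∈E , i , eq′) ◅ route) | inj₁ eq
        with refl ← tail-injective e∈E f∈E (trans eq (sym eq′))
        with refl ← joins-other j i = y , y∈c , route

      reaches-walk : ∀ {u v} → Walk G u v → Reaches u → Reaches v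
      reaches-walk (stop _)         = λ reaches → reaches
      reaches-walk (step _ e∈E j p) = reaches-walk p ∘ reaches-step e∈E j

      arcs-stay : ∀ {x y} → x ∈ˡ vertices walk → Star Arc x y → y ∈ˡ vertices walk
      arcs-stay x∈c ε = x∈c
      arcs-stay x∈c ((_ , e∈E , j , eq) ◅ route) = arcs-stay (cycle-closed x∈c e∈E eq j) route

    -- `c` is consistently oriented. Following its arcs from `z` leads to its base without leaving
    -- `c′`, and a full turn from there puts every edge of `c` on `c′`.
    intersecting-cycles : ∀ (c c′ : Cycle G) {z} → z ∈ˡ vertices (Cycle.walk c) →
      z ∈ˡ vertices (Cycle.walk c′) → ∀ {e} → e ∈ˡ edges (Cycle.walk c) → e ∈ˡ edges (Cycle.walk c′)
    intersecting-cycles c c′ z∈c z∈c′ e∈c with oriented (Cycle.walk c) (Cycle.distinct-edges c)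
    ... | inj₁ fwd = All.lookup (proj₁ (forward-from c′ fwd (forward-end c′ fwd z∈c z∈c′))) e∈c
    ... | inj₂ bwd = All.lookup (proj₁ (backward-from c′ bwd (backward-start c′ bwd z∈c z∈c′))) e∈c

    -- The base of `c′` is connected to that of `c` through `r`, so arcs lead from it to some `z` on
    -- `c`. This route starts on `c′` and cannot leave it, hence `z` lies on both cycles.
    injective-tails⇒pseudoforest : IsPseudoforest G
    injective-tails⇒pseudoforest r _ c c′ c-in c′-in
      with _ , z∈c , route ← reaches-walk c
             (All.lookup c′-in (base-visited c′))
             (reaches-walk c (reverse (All.lookup c-in (base-visited c)))
               (_ , base-visited c , ε))
      with z∈c′ ← arcs-stay c′ (base-visited c′) route =
      mk⇔ (intersecting-cycles c c′ z∈c z∈c′) (intersecting-cycles c′ c z∈c′ z∈c)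

-- Orientations of bounded indegree

  module _ (ρ : ℕ) where

    Slot : Set
    Slot = Fin n × Fin ρ

    -- A matching of the edges of `A` into slots. The vertex of a slot becomes the tail of its edge,
    -- the index selects the part of the partition. Values of `h` outside `A` carry no meaning.
    record IsAssignment (A : Subset m) (h : Fin m → Slot) : Set where
      field
        assigned-end : ∀ {e} → e ∈ A → IsEnd (proj₁ (h e)) e
        injective    : ∀ {e f} → e ∈ A → f ∈ A → h e ≡ h f → e ≡ f

    open IsAssignment

    Free : Subset m → (Fin m → Slot) → Slot → Set
    Free A h s = ∀ {e} → e ∈ A → h e ≢ s

    assign : (Fin m → Slot) → Fin m → Slot → Fin m → Slot
    assign h e s = updateAt h e (const s)

    -- `e` may be new or already in `A`, so this covers both placing an edge and moving one.
    assign-isAssignment : ∀ {A h e s} → IsAssignment A h → Free A h s → IsEnd (proj₁ s) e →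
      IsAssignment (A ∪ ⁅ e ⁆) (assign h e s)
    assign-isAssignment {A} {h} {e} {s} isA free s-end = record
      { assigned-end = ends′ ; injective = inj′ }
      where
      at-e : assign h e s e ≡ s
      at-e = updateAt-updates e h
      off-e : ∀ {f} → f ≢ e → assign h e s f ≡ h f
      off-e {f} = updateAt-minimal f e h
      old : ∀ {f} → f ∈ A ∪ ⁅ e ⁆ → f ≢ e → f ∈ A
      old f∈ f≢e with y∈p∪⁅x⁆⁻ A f∈
      ... | inj₁ f∈A = f∈A
      ... | inj₂ f≡e = contradiction f≡e f≢e
      ends′ : ∀ {f} → f ∈ A ∪ ⁅ e ⁆ → IsEnd (proj₁ (assign h e s f)) f
      ends′ {f} f∈ with f ≟ e
      ... | yes refl = subst (λ t → IsEnd (proj₁ t) e) (sym at-e) s-end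
      ... | no  f≢e  = subst (λ t → IsEnd (proj₁ t) f) (sym (off-e f≢e)) (assigned-end isA (old f∈ f≢e))
      inj′ : ∀ {f g} → f ∈ A ∪ ⁅ e ⁆ → g ∈ A ∪ ⁅ e ⁆ → assign h e s f ≡ assign h e s g → f ≡ g
      inj′ {f} {g} f∈ g∈ eq with f ≟ e | g ≟ e
      ... | yes refl | yes refl = refl
      ... | yes refl | no  g≢e  =
        contradiction (trans (sym (off-e g≢e)) (trans (sym eq) at-e)) (free (old g∈ g≢e))
      ... | no  f≢e  | yes refl =
        contradiction (trans (sym (off-e f≢e)) (trans eq at-e)) (free (old f∈ f≢e))
      ... | no  f≢e  | no  g≢e  =
        injective isA (old f∈ f≢e) (old g∈ g≢e) (trans (sym (off-e f≢e)) (trans eq (off-e g≢e)))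

    restrict : ∀ {A B h} → A ⊆ B → IsAssignment B h → IsAssignment A h
    restrict A⊆B isA = record
      { assigned-end = assigned-end isA ∘ A⊆B
      ; injective    = λ e∈ f∈ → injective isA (A⊆B e∈) (A⊆B f∈)
      }

    -- Freeing slots by moving edges

    module _ {A : Subset m} {h : Fin m → Slot} (isA : IsAssignment A h) where

      -- The outcome of an alternating path that vacates a slot of `x`. Moves are confined to edges
      -- with tail in `R`, so edges with tails elsewhere stay available for extending the path.
      Freeable : Subset n → Fin n → Set
      Freeable R x = ∃ λ h′ → IsAssignment A h′ ×
        (∀ {e} → e ∈ A → proj₁ (h e) ∉ R → h′ e ≡ h e) × ∃ λ i → Free A h′ (x , i)

      Freeable-mono : ∀ {R R′ x} → R ⊆ R′ → Freeable R x → Freeable R′ x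
      Freeable-mono R⊆R′ (h′ , isA′ , agree , slot) =
        h′ , isA′ , (λ e∈A ∉R′ → agree e∈A (∉R′ ∘ R⊆R′)) , slot

      Occupies : Slot → Fin m → Set
      Occupies s e = e ∈ A × h e ≡ s

      occupied? : ∀ s → Dec (∃ (Occupies s))
      occupied? s = any? λ e → e ∈? A ×-dec ≡-dec _≟_ _≟_ (h e) s

      Growable : Subset n → Fin n → Set
      Growable R y = y ∉ R ×
        ((∃ λ i → ¬ ∃ (Occupies (y , i))) ⊎
         (∃ λ e → e ∈ A × proj₁ (h e) ≡ y × (proj₁ (ends e) ∈ R ⊎ proj₂ (ends e) ∈ R)))

      growable? : ∀ R → Decidable (Growable R)
      growable? R y = ¬? (y ∈? R) ×-dec
        (any? (λ i → ¬? (occupied? (y , i))) ⊎-dec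
         any? (λ e → e ∈? A ×-dec proj₁ (h e) ≟ y ×-dec
                     (proj₁ (ends e) ∈? R ⊎-dec proj₂ (ends e) ∈? R)))

      -- The tail of e is outside R, so freeing x has not moved e, which can
      -- therefore be moved into the slot freed at x.
      free-via : ∀ {R e x} → e ∈ A → proj₁ (h e) ∉ R → x ∈ R → IsEnd x e → Freeable R x →
        Freeable (R ∪ ⁅ proj₁ (h e) ⁆) (proj₁ (h e))
      free-via {R} {e} {x} e∈A y∉R x∈R x-end (h′ , isA′ , agree , i , free) =
        assign h′ e (x , i) ,
        restrict (p⊆p∪q _) (assign-isAssignment isA′ free x-end) ,
        agree′ , proj₂ (h e) , free′
        where
        agree′ : ∀ {f} → f ∈ A → proj₁ (h f) ∉ R ∪ ⁅ proj₁ (h e) ⁆ → assign h′ e (x , i) f ≡ h f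
        agree′ {f} f∈A ∉R′ with f ≟ e
        ... | yes refl = contradiction (q⊆p∪q R _ (x∈⁅x⁆ _)) ∉R′
        ... | no  f≢e  = trans (updateAt-minimal f e h′ f≢e) (agree f∈A (∉R′ ∘ p⊆p∪q _))
        free′ : Free A (assign h′ e (x , i)) (h e)
        free′ {f} f∈A eq with f ≟ e
        ... | yes refl = y∉R (subst (_∈ R) (,-injectiveˡ (trans (sym (updateAt-updates e h′)) eq)) x∈R)
        ... | no  f≢e  = f≢e (injective isA′ f∈A e∈A
          (trans (sym (updateAt-minimal f e h′ f≢e)) (trans eq (sym (agree e∈A y∉R)))))

      freeable-set : ∃ λ R → (∀ {x} → x ∈ R → Freeable R x) × ¬ ∃ (Growable R)
      freeable-set = saturate (λ R → ∀ {x} → x ∈ R → Freeable R x) grow ⊥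
        (λ x∈⊥ → contradiction x∈⊥ ∉⊥)
        where
        extend : ∀ {R y} → (∀ {x} → x ∈ R → Freeable R x) → Freeable (R ∪ ⁅ y ⁆) y →
          ∀ {x} → x ∈ R ∪ ⁅ y ⁆ → Freeable (R ∪ ⁅ y ⁆) x
        extend {R} all new x∈ with y∈p∪⁅x⁆⁻ R x∈
        ... | inj₁ x∈R  = Freeable-mono (p⊆p∪q _) (all x∈R)
        ... | inj₂ refl = new
        grow : ∀ R → (∀ {x} → x ∈ R → Freeable R x) → ¬ ∃ (Growable R) ⊎
          ∃ λ y → y ∉ R × (∀ {x} → x ∈ R ∪ ⁅ y ⁆ → Freeable (R ∪ ⁅ y ⁆) x)
        grow R all with any? (growable? R)
        ... | no closed = inj₁ closed
        ... | yes (y , y∉R , inj₁ (i , unoccupied)) = inj₂ (y , y∉R ,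
          extend all (h , isA , (λ _ _ → refl) , i , λ e∈A eq → unoccupied (_ , e∈A , eq)))
        ... | yes (y , y∉R , inj₂ (e , e∈A , refl , inj₁ u∈R)) = inj₂ (y , y∉R ,
          extend all (free-via e∈A y∉R u∈R (inj₁ refl) (all u∈R)))
        ... | yes (y , y∉R , inj₂ (e , e∈A , refl , inj₂ v∈R)) = inj₂ (y , y∉R ,
          extend all (free-via e∈A y∉R v∈R (inj₂ refl) (all v∈R)))

      -- The edges occupying the slots of a set that cannot be freed all lie
      -- inside that set, which together with e makes it too dense.
      stuck⇒dense : ∀ {R e} → A ⊆ E → ¬ ∃ (Growable R) → e ∈ E → e ∉ A →
        proj₁ (ends e) ∉ R → proj₂ (ends e) ∉ R → ρ ℕ.* ∣ V ─ R ∣ ℕ.< ∣ E[ V ─ R ] ∣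
      stuck⇒dense {R} {e} A⊆E closed e∈E e∉A u∉R v∉R = ℕ.≤-<-trans
        -- `e` lies in `E[ K ]` but holds no slot; taking it out makes the inequality strict.
        (packing⇒k*s≤∣q∣ class (E[ K ] - e) class⊆
          (λ f∈i f∈j → trans (sym (proj₂ (proj₂ (∈-comprehension⁻ (class? _) f∈i))))
                             (proj₂ (proj₂ (∈-comprehension⁻ (class? _) f∈j))))
          class-size)
        (x∈p⇒∣p-x∣<∣p∣ (E[]-complete (e∈E ,
          x∈p∧x∉q⇒x∈p─q (proj₁ (ends∈V e∈E)) u∉R , x∈p∧x∉q⇒x∈p─q (proj₂ (ends∈V e∈E)) v∉R)))
        where
        K : Subset n
        K = V ─ R
        class? : ∀ i → Decidable λ f → f ∈ A × proj₁ (h f) ∈ K × proj₂ (h f) ≡ i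
        class? i f = f ∈? A ×-dec proj₁ (h f) ∈? K ×-dec proj₂ (h f) ≟ i
        class : Fin ρ → Subset m
        class i = comprehension (class? i)
        class⊆ : ∀ i → class i ⊆ E[ K ] - e
        class⊆ i {f} f∈ with f∈A , y∈K , _ ← ∈-comprehension⁻ (class? i) f∈ =
          x∈p∧x≢y⇒x∈p-y
            (E[]-complete (A⊆E f∈A ,
              x∈p∧x∉q⇒x∈p─q (proj₁ (ends∈V (A⊆E f∈A))) (λ ∈R → closed (_ , y∉R , inj₂ (f , f∈A , refl , inj₁ ∈R))) ,
              x∈p∧x∉q⇒x∈p─q (proj₂ (ends∈V (A⊆E f∈A))) (λ ∈R → closed (_ , y∉R , inj₂ (f , f∈A , refl , inj₂ ∈R)))))
            λ f≡e → e∉A (subst (_∈ A) f≡e f∈A)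
          where
          y∉R : proj₁ (h f) ∉ R
          y∉R = x∈p─q⇒x∉q V R (proj₁ (proj₂ (∈-comprehension⁻ (class? i) f∈)))
        occupant : ∀ i x → ∃ λ f → x ∈ K → Occupies (x , i) f
        occupant i x with occupied? (x , i)
        ... | yes (f , occ) = f , λ _ → occ
        -- For `x` outside `K` the value `e` is a dummy; for `x` in `K` a vacant slot would make `x`
        -- growable.
        ... | no  free      = e , λ x∈K → contradiction (x , x∈p─q⇒x∉q V R x∈K , inj₁ (i , free)) closed
        class-size : ∀ i → ∣ K ∣ ℕ.≤ ∣ class i ∣
        class-size i = injectiveOn⇒∣p∣≤∣q∣ K (class i) (proj₁ ∘ occupant i) into inj
          where
          into : ∀ {x} → x ∈ K → proj₁ (occupant i x) ∈ class i
          into {x} x∈K with f∈A , eq ← proj₂ (occupant i x) x∈K =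
            ∈-comprehension⁺ (class? i)
              (f∈A , subst (_∈ K) (sym (cong proj₁ eq)) x∈K , cong proj₂ eq)
          inj : ∀ {x y} → x ∈ K → y ∈ K → proj₁ (occupant i x) ≡ proj₁ (occupant i y) → x ≡ y
          inj {x} {y} x∈K y∈K eq = cong proj₁
            (trans (sym (proj₂ (proj₂ (occupant i x) x∈K)))
                   (trans (cong h eq) (proj₂ (proj₂ (occupant i y) y∈K))))

    Sparse : Set
    Sparse = ∀ S → Nonempty S → S ⊆ V → ∣ E[ S ] ∣ ℕ.≤ ρ ℕ.* ∣ S ∣

    -- An augmentation step of bipartite matching: either a slot can be freed at an end of `e`, or
    -- `V ─ R` is an obstruction of Hall type, which `Sparse` forbids.
    extend-assignment : ∀ {A h e} → Sparse → A ⊆ E → IsAssignment A h → e ∈ E → e ∉ A →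
      ∃ (IsAssignment (A ∪ ⁅ e ⁆))
    extend-assignment {A} {h} {e} sparse A⊆E isA e∈E e∉A with freeable-set isA
    ... | R , all , closed with proj₁ (ends e) ∈? R | proj₂ (ends e) ∈? R
    ...   | yes u∈R | _ with _ , isA′ , _ , _ , free ← all u∈R =
      _ , assign-isAssignment isA′ free (inj₁ refl)
    ...   | no _ | yes v∈R with _ , isA′ , _ , _ , free ← all v∈R =
      _ , assign-isAssignment isA′ free (inj₂ refl)
    ...   | no u∉R | no v∉R = contradiction
      (sparse (V ─ R) (_ , x∈p∧x∉q⇒x∈p─q (proj₁ (ends∈V e∈E)) u∉R) (p─q⊆p V R))
      (ℕ.<⇒≱ (stuck⇒dense isA A⊆E closed e∈E e∉A u∉R v∉R))

    sparse⇒assignment : .{{NonZero ρ}} → Sparse → ∃ (IsAssignment E)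
    sparse⇒assignment sparse =
      let _ , (_ , h , isA) , E⊆A = saturate (λ A → A ⊆ E × ∃ (IsAssignment A)) grow ⊥ empty
      in h , restrict E⊆A isA
      where
      empty : ⊥ ⊆ E × ∃ (IsAssignment ⊥)
      -- Any slot may serve as initial value on the empty set; positivity of `ρ` supplies its index.
      empty = (λ x∈⊥ → contradiction x∈⊥ ∉⊥) , (λ e → proj₁ (ends e) , fromℕ< (ℕ.>-nonZero⁻¹ ρ)) , record
        { assigned-end = λ x∈⊥ → contradiction x∈⊥ ∉⊥
        ; injective    = λ x∈⊥ → contradiction x∈⊥ ∉⊥
        }
      grow : ∀ A → A ⊆ E × ∃ (IsAssignment A) →
        E ⊆ A ⊎ ∃ λ e → e ∉ A × A ∪ ⁅ e ⁆ ⊆ E × ∃ (IsAssignment (A ∪ ⁅ e ⁆))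
      grow A (A⊆E , h , isA) with nonempty? (E ─ A)
      ... | no  empty = inj₁ E⊆A
        where
        E⊆A : E ⊆ A
        E⊆A {e} e∈E with e ∈? A
        ... | yes e∈A = e∈A
        ... | no  e∉A = contradiction (e , x∈p∧x∉q⇒x∈p─q e∈E e∉A) empty
      ... | yes (e , e∈) = inj₂ (e , e∉A , A∪e⊆E , extend-assignment sparse A⊆E isA e∈E e∉A)
        where
        e∈E : e ∈ E
        e∈E = p─q⊆p E A e∈
        e∉A : e ∉ A
        e∉A = x∈p─q⇒x∉q E A e∈
        A∪e⊆E : A ∪ ⁅ e ⁆ ⊆ E
        A∪e⊆E f∈ with y∈p∪⁅x⁆⁻ A f∈
        ... | inj₁ f∈A  = A⊆E f∈A
        ... | inj₂ refl = e∈E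

-- Maximum density

∈-subsets : ∀ (S : Subset n) → S ∈ˡ subsets n
∈-subsets []            = here refl
∈-subsets (outside ∷ S) = ∈-++⁺ˡ (∈-map⁺ (outside ∷_) (∈-subsets S))
∈-subsets (inside ∷ S)  = ∈-++⁺ʳ _ (∈-map⁺ (inside ∷_) (∈-subsets S))

-- Cross-multiplication, carried out on unnormalised fractions because `_/_` reduces to lowest
-- terms.
ratio≤⇔ : ∀ p {q} ρ → 0 ℕ.< q → ratio p q ≤ + ρ / 1 ⇔ p ℕ.≤ ρ ℕ.* q
ratio≤⇔ p {suc q} ρ _ = mk⇔ to from
  where
  p/q ρ/1 : ℚᵘ.ℚᵘ
  -- `mkℚᵘ` takes the denominator minus one.
  p/q = mkℚᵘ (+ p) q
  ρ/1 = mkℚᵘ (+ ρ) 0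
  to : + p / suc q ≤ + ρ / 1 → p ℕ.≤ ρ ℕ.* suc q
  to le with *≤* le′ ← ℚᵘ.≤-respˡ-≃ (toℚᵘ-fromℚᵘ p/q) (ℚᵘ.≤-respʳ-≃ (toℚᵘ-fromℚᵘ ρ/1) (toℚᵘ-mono-≤ le)) =
    ℤ.drop‿+≤+ (subst₂ ℤ._≤_ (ℤ.*-identityʳ (+ p)) (sym (ℤ.pos-* ρ (suc q))) le′)
  from : p ℕ.≤ ρ ℕ.* suc q → + p / suc q ≤ + ρ / 1
  from le = toℚᵘ-cancel-≤
    (ℚᵘ.≤-respˡ-≃ (ℚᵘ.≃-sym (toℚᵘ-fromℚᵘ p/q)) (ℚᵘ.≤-respʳ-≃ (ℚᵘ.≃-sym (toℚᵘ-fromℚᵘ ρ/1))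
      (*≤* (subst₂ ℤ._≤_ (sym (ℤ.*-identityʳ (+ p))) (ℤ.pos-* ρ (suc q)) (ℤ.+≤+ le)))))

foldr-⊔≤⇔ : ∀ {A : Set} (f : A → ℚ) xs {c} → 0ℚ ≤ c →
  foldr _⊔_ 0ℚ (map f xs) ≤ c ⇔ (∀ {x} → x ∈ˡ xs → f x ≤ c)
foldr-⊔≤⇔ f xs {c} 0≤c = mk⇔ (to xs) (from xs)
  where
  to : ∀ xs → foldr _⊔_ 0ℚ (map f xs) ≤ c → ∀ {x} → x ∈ˡ xs → f x ≤ c
  to (x ∷ xs) le (here refl) = ≤-trans (p≤p⊔q (f x) _) le
  to (x ∷ xs) le (there y∈)  = to xs (≤-trans (p≤q⊔p (f x) _) le) y∈
  from : ∀ xs → (∀ {x} → x ∈ˡ xs → f x ≤ c) → foldr _⊔_ 0ℚ (map f xs) ≤ c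
  from []       _   = 0≤c
  from (x ∷ xs) all = ⊔-lub (all (here refl)) (from xs (all ∘ there))

λ*≤⇔Sparse : ∀ (G : Graph n m) ρ → λ* G ≤ + ρ / 1 ⇔ Sparse G ρ
λ*≤⇔Sparse {n = n} G ρ = mk⇔ to from
  where
  IsVertexSet : Subset n → Set
  IsVertexSet S = Nonempty S × S ⊆ Graph.V G
  isVertexSet? : Decidable IsVertexSet
  isVertexSet? S = nonempty? S ×-dec S ⊆? Graph.V G
  density⇔ : ∀ S → Nonempty S → density G S ≤ + ρ / 1 ⇔ ∣ Graph.E[_] G S ∣ ℕ.≤ ρ ℕ.* ∣ S ∣
  density⇔ S (x , x∈S) = ratio≤⇔ _ ρ (ℕ.≤-<-trans z≤n (x∈p⇒∣p-x∣<∣p∣ x∈S))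
  max⇔ : λ* G ≤ + ρ / 1 ⇔ (∀ {S} → S ∈ˡ nonemptyVertexSets G → density G S ≤ + ρ / 1)
  max⇔ = foldr-⊔≤⇔ (density G) (nonemptyVertexSets G)
    -- `ratio 0 1` is `0ℚ`, so this bounds the starting value of the maximum.
    (Equivalence.from (ratio≤⇔ 0 {1} ρ (s≤s z≤n)) z≤n)
  to : λ* G ≤ + ρ / 1 → Sparse G ρ
  to le S nonempty S⊆V = Equivalence.to (density⇔ S nonempty)
    (Equivalence.to max⇔ le (∈-filter⁺ {P = IsVertexSet} isVertexSet? (∈-subsets S) (nonempty , S⊆V)))
  from : Sparse G ρ → λ* G ≤ + ρ / 1
  from sparse = Equivalence.from max⇔ λ {S} S∈ →
    let S-vertexSet = proj₂ (∈-filter⁻ {P = IsVertexSet} isVertexSet? {xs = subsets n} S∈) in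
    Equivalence.from (density⇔ S (proj₁ S-vertexSet))
      (sparse S (proj₁ S-vertexSet) (proj₂ S-vertexSet))

-- Partitions into pseudoforests and sparsity

foldUnion⇒Sparse : ∀ (G : Graph n m) ρ F → let open Graph G in
  Indep (foldUnion ρ (pseudoforestMatroid G)) E[ V ─ F ] → Sparse (G -ᵍ F) ρ
foldUnion⇒Sparse G ρ F (_ , P , partition , indep) S _ S⊆V─F =
  cover⇒∣q∣≤k*s (λ i → Graph.E[_] (part i) S) (Graph.E[_] (G -ᵍ F) S) covers′
    -- Every part spans all of `V`, so a set `S` inside `V ─ F` is a vertex set of each part.
    λ i → pseudoforest⇒∣E[S]∣≤∣S∣ (part i) (proj₂ (indep i)) S (p─q⊆p (Graph.V G) F ∘ S⊆V─F)
  where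
  open IsPartition partition
  part : Fin ρ → Graph _ _
  part i = spanning G (P i) (proj₁ (indep i))
  covers′ : ∀ {e} → e ∈ Graph.E[_] (G -ᵍ F) S → ∃ λ i → e ∈ Graph.E[_] (part i) S
  covers′ e∈ with e∈E , u∈S , v∈S ← Graph.E[]-sound (G -ᵍ F) e∈ with i , e∈P ← covers e∈E =
    i , E[]-complete (part i) (e∈P , u∈S , v∈S)

-- The slot index of an edge selects its part. Inside one part equal tails mean equal slots, so
-- tails are injective there and the part is a pseudoforest.
Sparse⇒foldUnion : ∀ (G : Graph n m) ρ .{{_ : NonZero ρ}} F → let open Graph G in
  Sparse (G -ᵍ F) ρ → Indep (foldUnion ρ (pseudoforestMatroid G)) E[ V ─ F ]
Sparse⇒foldUnion {m = m} G ρ F sparse with h , isA ← sparse⇒assignment (G -ᵍ F) ρ sparse =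
  (λ e∈ → proj₁ (E[]-sound e∈)) , class , partition , λ i →
    (λ e∈ → proj₁ (E[]-sound (proj₁ (class-sound e∈)))) ,
    injective-tails⇒pseudoforest (spanning G (class i) _) (proj₁ ∘ h)
      (λ e∈ → assigned-end (proj₁ (class-sound e∈)))
      λ e∈ f∈ eq → injective (proj₁ (class-sound e∈)) (proj₁ (class-sound f∈))
        (cong₂ _,_ eq (trans (proj₂ (class-sound e∈)) (sym (proj₂ (class-sound f∈)))))
  where
  open Graph G
  open IsAssignment isA
  class? : ∀ i → Decidable λ e → e ∈ E[ V ─ F ] × proj₂ (h e) ≡ i
  class? i e = e ∈? E[ V ─ F ] ×-dec proj₂ (h e) ≟ i
  class : Fin ρ → Subset m
  class i = comprehension (class? i)
  class-sound : ∀ {i e} → e ∈ class i → e ∈ E[ V ─ F ] × proj₂ (h e) ≡ i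
  class-sound {i} = ∈-comprehension⁻ (class? i)
  partition : IsPartition E[ V ─ F ] class
  partition = record
    { part⊆    = λ _ e∈ → proj₁ (class-sound e∈)
    ; covers   = λ {e} e∈ → proj₂ (h e) , ∈-comprehension⁺ (class? _) (e∈ , refl)
    ; disjoint = λ e∈i e∈j → trans (sym (proj₂ (class-sound e∈i))) (proj₂ (class-sound e∈j))
    }

theoremA2 : ∀ {n m : ℕ} (G : Graph n m) (ρ : ℕ) .{{_ : NonZero ρ}} →
    let open Graph G in
    (F : Subset n) → F ⊆ V →
    Indep (foldUnion ρ (pseudoforestMatroid G)) E[ V ─ F ] ⇔ λ* (G -ᵍ F) ≤ + ρ / 1
theoremA2 G ρ F _ = mk⇔
  (Equivalence.from (λ*≤⇔Sparse (G -ᵍ F) ρ) ∘ foldUnion⇒Sparse G ρ F)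
  (Sparse⇒foldUnion G ρ F ∘ Equivalence.to (λ*≤⇔Sparse (G -ᵍ F) ρ))
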